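{- For every pair of integers $\ell\ge 3$ with $\ell\neq 5$, and $r\ge 2$, the generalised H-graph $H^\ell(r)$ satisfies $\chi_\rho(H^\ell(r))=5$ if $r$ is even, and $\chi_\rho(H^\ell(r))=6$ if $r$ is odd.
   Context: All graphs are simple; $d_G(u,v)$ is the shortest-path distance. A packing $k$-colouring of $G$ is a map $\pi:V(G)\to\{1,\dots,k\}$ such that for distinct $u,v$, $\pi(u)=\pi(v)=i$ implies $d_G(u,v)>i$; $\chi_\rho(G)$ is the least $k$ for which a packing $k$-colouring exists. For integers $r\ge 2$ and $\ell\ge 1$, the generalised H-graph $H^\ell(r)$ has vertex set $\{u^i_j: 0\le i\le \ell+1,\ 0\le j\le 2r-1\}$ and edge set consisting of: $u^0_ju^0_{j+1}$ and $u^{\ell+1}_ju^{\ell+1}_{j+1}$ for $0\le j\le 2r-1$ (subscripts modulo $2r$); $u^i_{2j}u^i_{2j+1}$ for $1\le i\le \ell$, $0\le j\le r-1$; and $u^i_ju^{i+1}_j$ for $0\le i\le \ell$, $0\le j\le 2r-1$. It is 3-regular of order $2r(\ell+2)$. -}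

module Defs where

open import Data.Nat using (ℕ; zero; suc; _+_; _*_; _≤_; _<_)
open import Data.Fin using (Fin; toℕ)
open import Data.Product using (_×_; _,_; Σ; ∃)
open import Data.Sum using (_⊎_)
open import Relation.Binary.PropositionalEquality using (_≡_)
open import Relation.Nullary using (¬_)

record Graph : Set₁ where
  field
    V   : Set
    Adj : V → V → Set
open Graph public

data Walk (G : Graph) : V G → V G → ℕ → Set where
  here : ∀ {u} → Walk G u u 0
  step : ∀ {u w v k} → Adj G u w → Walk G w v k → Walk G u v (suc k)

-- d_G(u,v) ≤ i  iff there is a walk of length at most i from u to v
-- (shortest-path distance; d = ∞ if no such walk exists).
DistLe : (G : Graph) → V G → V G → ℕ → Set
DistLe G u v i = Σ ℕ λ k → k ≤ i × Walk G u v k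

DistGt : (G : Graph) → V G → V G → ℕ → Set
DistGt G u v i = ¬ DistLe G u v i

IsPackingColouring : (G : Graph) → ℕ → (V G → ℕ) → Set
IsPackingColouring G k π =
  (∀ v → 1 ≤ π v × π v ≤ k) ×
  (∀ u v i → ¬ (u ≡ v) → π u ≡ i → π v ≡ i → DistGt G u v i)

HasPackingColouring : Graph → ℕ → Set
HasPackingColouring G k = Σ (V G → ℕ) λ π → IsPackingColouring G k π

PackingChromaticNumber : Graph → ℕ → Set
PackingChromaticNumber G k =
  HasPackingColouring G k × (∀ m → m < k → ¬ HasPackingColouring G m)

-- Generalised H-graph H^ℓ(r): vertex u^i_j is (i , j) with
-- 0 ≤ i ≤ ℓ+1, 0 ≤ j ≤ 2r-1.
HVert : ℕ → ℕ → Set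
HVert ℓ r = Fin (ℓ + 2) × Fin (2 * r)

SuccMod : ℕ → ℕ → ℕ → Set
SuccMod r j j' = (j' ≡ suc j) ⊎ ((suc j ≡ 2 * r) × (j' ≡ 0))

-- One orientation of each edge of H^ℓ(r).
data HEdge (ℓ r : ℕ) : HVert ℓ r → HVert ℓ r → Set where
  ring0   : ∀ {i i' j j'} → toℕ i ≡ 0 → toℕ i' ≡ 0 →
            SuccMod r (toℕ j) (toℕ j') → HEdge ℓ r (i , j) (i' , j')
  ringTop : ∀ {i i' j j'} → toℕ i ≡ suc ℓ → toℕ i' ≡ suc ℓ →
            SuccMod r (toℕ j) (toℕ j') → HEdge ℓ r (i , j) (i' , j')
  rung    : ∀ {i i' j j'} (m : ℕ) → 1 ≤ toℕ i → toℕ i ≤ ℓ → toℕ i' ≡ toℕ i →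
            toℕ j ≡ 2 * m → toℕ j' ≡ suc (2 * m) → HEdge ℓ r (i , j) (i' , j')
  vert    : ∀ {i i' j j'} → toℕ i' ≡ suc (toℕ i) → toℕ j' ≡ toℕ j →
            HEdge ℓ r (i , j) (i' , j')

H : ℕ → ℕ → Graph
H ℓ r = record
  { V   = HVert ℓ r
  ; Adj = λ u v → HEdge ℓ r u v ⊎ HEdge ℓ r v u
  }

Even : ℕ → Set
Even r = Σ ℕ λ m → r ≡ 2 * m

Odd : ℕ → Set
Odd r = Σ ℕ λ m → r ≡ suc (2 * m)

-- H^ℓ(r) is a ring of r ladders, each joined to its neighbours at the bottom and at the top row.
--
-- Lower bounds. Three rows of two neighbouring ladders have no packing 4-colouring. In a packing 5-colouring, four rows
-- of three consecutive ladders force the bottom rung of the middle ladder to contain colour 1; since these 1s cannot be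
-- adjacent, they are all on the left or all on the right of their rungs. The same windows then exclude 4 and 5 from the
-- other ends, which therefore alternate between 2 and 3 around the ring, so that r is even.
--
-- Upper bounds. A colouring is given by a cyclic word of ladder types and, for each type, a sequence of rows
-- prefix ++ block ^ k ++ suffix with a block of six rows; the prefix fixes the residue of ℓ modulo 6. As walks of length
-- at most 6 only see a window of bounded size, finitely many windows have to be checked for all ℓ and r.

{-# OPTIONS --safe #-}
module Submission where

open import Defs
open import Data.Bool using (Bool; true; false; not; _∧_; _∨_; T; if_then_else_)
open import Data.Bool.ListAction using (all; any)
open import Data.Bool.Properties using (T-∧; T-∨)
open import Data.Empty using (⊥; ⊥-elim)
open import Data.Fin using (Fin; toℕ; fromℕ<)
open import Data.Fin.Patterns using (0F; 1F; 2F; 3F; 4F; 5F)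
open import Data.Fin.Properties using (toℕ<n; toℕ-injective; toℕ-fromℕ<)
open import Data.List using (List; []; _∷_; _++_; length; upTo; _ʳ++_; map)
open import Data.List.Membership.Propositional using (_∈_)
open import Data.List.Membership.Propositional.Properties using (∈-upTo⁺; ∈-map⁺)
open import Data.List.Properties using (length-++)
open import Data.List.Relation.Unary.All using (All; []; _∷_)
open import Data.List.Relation.Unary.Any using (here; there)
open import Data.Nat using (ℕ; zero; suc; _+_; _*_; _∸_; _≤_; _<_; z≤n; s≤s; _≡ᵇ_; _≤ᵇ_; _/_; _%_; NonZero; >-nonZero; _<ᵇ_)
open import Data.Nat.DivMod using ([m+kn]%n≡m%n; m<n⇒m%n≡m; m%n<n; m≡m%n+[m/n]*n; [m+n]%n≡m%n; n%n≡0)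
open import Data.Nat.Properties
open import Data.Nat.Tactic.RingSolver using (solve-∀)
open import Data.Product using (_×_; _,_; ∃; ∃₂; proj₁; proj₂)
open import Data.Sum using (_⊎_; inj₁; inj₂)
open import Data.Unit using (tt; ⊤)
open import Function using (_∘_)
open import Function.Bundles using (Equivalence)
open import Relation.Binary.Definitions using (tri<; tri≈; tri>)
open import Relation.Binary.PropositionalEquality
open import Relation.Nullary using (¬_; yes; no)

-- Checking a colouring on windows

∧-elim : ∀ a {b} → T (a ∧ b) → T a × T b
∧-elim a = Equivalence.to (T-∧ {a})

∨-elim : ∀ a {b} → T (a ∨ b) → T a ⊎ T b
∨-elim a = Equivalence.to (T-∨ {a})

modusPonens : ∀ a {b} → T (not a ∨ b) → T a → T b
modusPonens true p _ = p

all-elim : ∀ {A : Set} (f : A → Bool) {xs x} → T (all f xs) → x ∈ xs → T (f x)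
all-elim f {y ∷ _} p (here refl) = proj₁ (∧-elim (f y) p)
all-elim f {y ∷ _} p (there x∈) = all-elim f (proj₂ (∧-elim (f y) p)) x∈

-- Columns as ladder and side, edges as moves

inc : ℕ × Bool → ℕ × Bool
inc (p , false) = p , true
inc (p , true) = suc p , false

-- Quotient and parity of a column by unary recursion, so that a step along a ring computes to
-- `inc`.
ladderSide : ℕ → ℕ × Bool
ladderSide zero = 0 , false
ladderSide (suc j) = inc (ladderSide j)

column : ℕ × Bool → ℕ
column (p , false) = 2 * p
column (p , true) = suc (2 * p)

column-inc : ∀ q → column (inc q) ≡ suc (column q)
column-inc (p , false) = refl
column-inc (p , true) = cong suc (+-suc p (p + 0))

column-ladderSide : ∀ j → column (ladderSide j) ≡ j
column-ladderSide zero = refl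
column-ladderSide (suc j) = trans (column-inc (ladderSide j)) (cong suc (column-ladderSide j))

ladderSide-2* : ∀ p → ladderSide (2 * p) ≡ (p , false)
ladderSide-2* zero = refl
ladderSide-2* (suc p) rewrite +-suc p (p + 0) | ladderSide-2* p = refl

ladder-bound : ∀ {r} j → j < 2 * r → proj₁ (ladderSide j) < r
ladder-bound {r} j j<2r = *-cancelˡ-< 2 _ _ (≤-<-trans (lower (ladderSide j)) (subst (_< 2 * r) (sym (column-ladderSide j)) j<2r))
  where
  lower : ∀ q → 2 * proj₁ q ≤ column q
  lower (p , false) = ≤-refl
  lower (p , true) = n≤1+n _

-- The bound `p' < r` excludes the first case at the last ladder, so that the successor is unique.
NextLadder : ℕ → ℕ → ℕ → Set
NextLadder r p p' = (p' ≡ suc p × p' < r) ⊎ (suc p ≡ r × p' ≡ 0)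

Coord : Set
Coord = ℕ × ℕ × Bool

-- A ring edge inside a ladder is a `flip`, just like a rung. The end rows thus differ from the
-- others only by the moves between ladders.
data Move (ℓ r : ℕ) : Coord → Coord → Set where
  flip  : ∀ {i p s} → Move ℓ r (i , p , s) (i , p , not s)
  up    : ∀ {i p s} → suc i < ℓ + 2 → Move ℓ r (i , p , s) (suc i , p , s)
  down  : ∀ {i p s} → Move ℓ r (suc i , p , s) (i , p , s)
  right : ∀ {i p p'} → (i ≡ 0 ⊎ i ≡ suc ℓ) → NextLadder r p p' → Move ℓ r (i , p , true) (i , p' , false)
  left  : ∀ {i p p'} → (i ≡ 0 ⊎ i ≡ suc ℓ) → NextLadder r p' p → Move ℓ r (i , p , false) (i , p' , true)

coord : ∀ {ℓ r} → HVert ℓ r → Coord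
coord (i , j) = toℕ i , ladderSide (toℕ j)

coord-injective : ∀ {ℓ r} (u v : HVert ℓ r) → coord {ℓ} {r} u ≡ coord {ℓ} {r} v → u ≡ v
coord-injective (i , j) (i' , j') eq = cong₂ _,_ (toℕ-injective (cong proj₁ eq))
  (toℕ-injective (trans (sym (column-ladderSide (toℕ j)))
    (trans (cong (column ∘ proj₂) eq) (column-ladderSide (toℕ j')))))

ring-moves : ∀ {ℓ r i j j'} → (i ≡ 0 ⊎ i ≡ suc ℓ) → SuccMod r j j' → j' < 2 * r →
  Move ℓ r (i , ladderSide j) (i , ladderSide j') × Move ℓ r (i , ladderSide j') (i , ladderSide j)
ring-moves {r = r} {j = j} end (inj₁ refl) j'< with ladderSide j | ladder-bound {r} (suc j) j'<
... | p , false | _ = flip , flip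
... | p , true | b = right end (inj₁ (refl , b)) , left end (inj₁ (refl , b))
ring-moves {r = r} {j = j} end (inj₂ (j+1≡2r , refl)) _ with ladderSide j | trans (cong ladderSide j+1≡2r) (ladderSide-2* r)
... | p , false | ()
... | p , true | eq = right end (inj₂ (cong proj₁ eq , refl)) , left end (inj₂ (cong proj₁ eq , refl))

edge-moves : ∀ {ℓ r} {u v : HVert ℓ r} → HEdge ℓ r u v →
  Move ℓ r (coord {ℓ} {r} u) (coord {ℓ} {r} v) × Move ℓ r (coord {ℓ} {r} v) (coord {ℓ} {r} u)
edge-moves {r = r} (ring0 {j' = j'} i≡0 i'≡0 s) rewrite i≡0 | i'≡0 = ring-moves {r = r} (inj₁ refl) s (toℕ<n j')
edge-moves {r = r} (ringTop {j' = j'} i≡ i'≡ s) rewrite i≡ | i'≡ = ring-moves {r = r} (inj₂ refl) s (toℕ<n j')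
edge-moves (rung m _ _ i'≡i j≡ j'≡) rewrite i'≡i | j≡ | j'≡ | ladderSide-2* m = flip , flip
edge-moves (vert {i' = i'} i'≡ j'≡) with toℕ i' | toℕ<n i'
... | _ | b rewrite i'≡ | j'≡ = up b , down

step-move : ∀ {ℓ r} {u v : HVert ℓ r} → Adj (H ℓ r) u v → Move ℓ r (coord {ℓ} {r} u) (coord {ℓ} {r} v)
step-move (inj₁ e) = proj₁ (edge-moves e)
step-move (inj₂ e) = proj₂ (edge-moves e)

-- A Boolean check of all short walks

infix 4 _◂_▸_
data Zipper : Set where
  _◂_▸_ : List ℕ → ℕ → List ℕ → Zipper

-- The decimal digits of a row, from the right: digit 2t + s is the colour at side s of a ladder of type t.
cell : ℕ → ℕ → Bool → ℕ
cell x zero false = x % 10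
cell x zero true = (x / 10) % 10
cell x (suc t) s = cell (x / 100) t s

rowAt : List ℕ → ℕ → ℕ
rowAt [] _ = 0
rowAt (x ∷ xs) zero = x
rowAt (x ∷ xs) (suc i) = rowAt xs i

-- A walk starts at displacement 7 in both directions; its length is at most 6, so the displacement stays positive.
origin : ℕ
origin = 7

_≡ˢ_ : Bool → Bool → Bool
true ≡ˢ s = s
false ≡ˢ s = not s

≡ˢ-sound : ∀ s s' → T (s ≡ˢ s') → s ≡ s'
≡ˢ-sound true true _ = refl
≡ˢ-sound false false _ = refl

-- successors lists the types allowed to the right of a ladder of a given type; ladders at displacement period
-- are identified with the starting ladder.
record Pattern : Set where
  field
    colours types period : ℕ
    successors : ℕ → List ℕ

module Check (P : Pattern) where
  open Pattern P

  _⟶_ : ℕ → ℕ → Bool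
  t ⟶ t' = any (t' ≡ᵇ_) (successors t)

  module _ (c : ℕ) (s₀ : Bool) where
    atStart : ℕ → ℕ → Bool → Bool
    atStart y z s = (y ≡ᵇ origin) ∧ (s ≡ˢ s₀) ∧
      -- With `period` 0 the three alternatives coincide; otherwise a displacement by one period in
      -- either direction also counts as the start.
      ((z ≡ᵇ origin) ∨ (z ≡ᵇ origin + period) ∨ (z + period ≡ᵇ origin))

    -- Every walk of length at most k keeps clear of colour c away from the start. Ladders already seen are remembered
    -- in the second zipper; beyond them all admissible types are tried.
    walks moves goUp goDown cross : ℕ → Zipper → ℕ → Zipper → ℕ → Bool → Bool
    goRight goLeft : ℕ → Zipper → ℕ → Zipper → ℕ → Bool
    tryRight : ℕ → Zipper → ℕ → List ℕ → ℕ → ℕ → ℕ → Bool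
    tryLeft : ℕ → Zipper → ℕ → ℕ → List ℕ → ℕ → ℕ → Bool

    walks k (bs ◂ x ▸ as) y (ls ◂ t ▸ rs) z s =
      (not (cell x t s ≡ᵇ c) ∨ atStart y z s) ∧ moves k (bs ◂ x ▸ as) y (ls ◂ t ▸ rs) z s

    moves zero _ _ _ _ _ = true
    moves (suc k) X y Z z s = walks k X y Z z (not s) ∧ goUp k X y Z z s ∧ goDown k X y Z z s

    -- Nothing lies above the top row, where the move along the ring takes the place of the upward
    -- move; `goDown` does the same in the bottom row.
    goUp k (bs ◂ x ▸ []) y Z z s = cross k (bs ◂ x ▸ []) y Z z s
    goUp k (bs ◂ x ▸ x' ∷ as) y Z z s = walks k (x ∷ bs ◂ x' ▸ as) (suc y) Z z s

    goDown k ([] ◂ x ▸ as) y Z z s = cross k ([] ◂ x ▸ as) y Z z s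
    -- The default `false` is the safe one: an exhausted counter would fail the check, not pass it.
    goDown k (x' ∷ bs ◂ x ▸ as) zero Z z s = false
    goDown k (x' ∷ bs ◂ x ▸ as) (suc y) Z z s = walks k (bs ◂ x' ▸ x ∷ as) y Z z s

    cross k X y Z z true = goRight k X y Z z
    cross k X y Z zero false = false
    cross k X y Z (suc z) false = goLeft k X y Z z

    goRight k X y (ls ◂ t ▸ []) z = all (tryRight k X y ls t z) (upTo types)
    goRight k X y (ls ◂ t ▸ t' ∷ rs) z = walks k X y (t ∷ ls ◂ t' ▸ rs) (suc z) false

    goLeft k X y ([] ◂ t ▸ rs) z = all (tryLeft k X y t rs z) (upTo types)
    goLeft k X y (t' ∷ ls ◂ t ▸ rs) z = walks k X y (ls ◂ t' ▸ t ∷ rs) z true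

    tryRight k X y ls t z t' = not (t ⟶ t') ∨ walks k X y (t ∷ ls ◂ t' ▸ []) (suc z) false
    tryLeft k X y t rs z t' = not (t' ⟶ t) ∨ walks k X y ([] ◂ t' ▸ t ∷ rs) z true

  cellOK : ℕ → Zipper → ℕ → Bool → Bool
  cellOK c X t s = (1 ≤ᵇ c) ∧ (c ≤ᵇ colours) ∧ walks c s c X origin ([] ◂ t ▸ []) origin s

  rowOK : Zipper → Bool
  rowOK (bs ◂ x ▸ as) = all (λ t → cellOK (cell x t false) (bs ◂ x ▸ as) t false ∧
                                   cellOK (cell x t true) (bs ◂ x ▸ as) t true) (upTo types)

  sweep : List ℕ → List ℕ → Bool
  sweep bs [] = true
  sweep bs (x ∷ as) = rowOK (bs ◂ x ▸ as) ∧ sweep (x ∷ bs) as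

-- Soundness of the check

data Focus (rows : List ℕ) : ℕ → Zipper → Set where
  start : ∀ {x as} → rows ≡ x ∷ as → Focus rows 0 ([] ◂ x ▸ as)
  next  : ∀ {i bs x x' as} → Focus rows i (bs ◂ x ▸ x' ∷ as) → Focus rows (suc i) (x ∷ bs ◂ x' ▸ as)

focus-rowAt : ∀ {rows i bs x as} → Focus rows i (bs ◂ x ▸ as) → ∀ n → rowAt rows (i + n) ≡ rowAt (x ∷ as) n
focus-rowAt (start refl) n = refl
focus-rowAt {rows} {suc i} (next f) n = trans (cong (rowAt rows) (sym (+-suc i n))) (focus-rowAt f (suc n))

focus-length : ∀ {rows i bs x as} → Focus rows i (bs ◂ x ▸ as) → i + suc (length as) ≡ length rows
focus-length (start refl) = refl
focus-length {i = suc i} (next f) = trans (sym (+-suc i _)) (focus-length f)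

focus : ∀ rows i → i < length rows → ∃ (Focus rows i)
focus (x ∷ as) zero _ = _ , start refl
focus rows (suc i) i<n with focus rows i (<⇒≤ i<n)
... | (bs ◂ x ▸ x' ∷ as) , f = _ , next f
... | (bs ◂ x ▸ []) , f = ⊥-elim (<-irrefl (trans (sym (+-comm i 1)) (focus-length f)) i<n)

record Word (P : Pattern) (r : ℕ) : Set where
  open Pattern P
  field
    word       : ℕ → ℕ
    word-bound : ∀ p → word p < types
    word-next  : ∀ {p p'} → NextLadder r p p' → T (Check._⟶_ P (word p) (word p'))
    -- A displacement by one period must lead back to the same ladder of the ring; 0 satisfies this
    -- for every r.
    period-∣   : ∃ λ w → period ≡ w * r

NextLadder-functional : ∀ {r p q q'} → NextLadder r p q → NextLadder r p q' → q ≡ q'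
NextLadder-functional (inj₁ (refl , _)) (inj₁ (refl , _)) = refl
NextLadder-functional (inj₁ (refl , lt)) (inj₂ (refl , _)) = ⊥-elim (<-irrefl refl lt)
NextLadder-functional (inj₂ (refl , _)) (inj₁ (refl , lt)) = ⊥-elim (<-irrefl refl lt)
NextLadder-functional (inj₂ (_ , refl)) (inj₂ (_ , refl)) = refl

NextLadder-injective : ∀ {r p q q'} → NextLadder r q p → NextLadder r q' p → q ≡ q'
NextLadder-injective (inj₁ (refl , _)) (inj₁ (refl , _)) = refl
NextLadder-injective (inj₂ (refl , _)) (inj₂ (refl , _)) = refl
NextLadder-injective (inj₁ (refl , _)) (inj₂ (_ , ()))
NextLadder-injective (inj₂ (_ , refl)) (inj₁ (() , _))

-- Reduction modulo r removes the multiples. They stand on both sides so that displacements in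
-- either direction are expressed without subtraction.
residue-unique : ∀ {r p q} a b → p < r → q < r → p + a * r ≡ q + b * r → p ≡ q
residue-unique {r} {p} {q} a b p<r q<r eq = begin
  p                 ≡⟨ m<n⇒m%n≡m p<r ⟨
  p % r             ≡⟨ [m+kn]%n≡m%n p a r ⟨
  (p + a * r) % r   ≡⟨ cong (_% r) eq ⟩
  (q + b * r) % r   ≡⟨ [m+kn]%n≡m%n q b r ⟩
  q % r             ≡⟨ m<n⇒m%n≡m q<r ⟩
  q                 ∎
  where
  open ≡-Reasoning
  instance
    r≢0 : NonZero r
    r≢0 = >-nonZero (≤-<-trans z≤n p<r)

module Soundness (P : Pattern) {r : ℕ} (W : Word P r) (ℓ : ℕ) (rows : List ℕ) (rows-length : length rows ≡ ℓ + 2) where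
  open Pattern P
  open Check P
  open Word W

  colour : HVert ℓ r → ℕ
  colour v with coord {ℓ} {r} v
  ... | i , p , s = cell (rowAt rows i) (word p) s

  -- The remembered types belong to actual ladders, read along the unrolled ring; on a short ring
  -- one ladder may occur at several displacements.
  data Behind : ℕ → List ℕ → Set where
    []  : ∀ {p} → Behind p []
    _∷_ : ∀ {p p' ts} → NextLadder r p' p → Behind p' ts → Behind p (word p' ∷ ts)

  data Ahead : ℕ → List ℕ → Set where
    []  : ∀ {p} → Ahead p []
    _∷_ : ∀ {p p' ts} → NextLadder r p p' → Ahead p' ts → Ahead p (word p' ∷ ts)

  data Around (p : ℕ) : Zipper → Set where
    around : ∀ {ls rs} → Behind p ls → Ahead p rs → Around p (ls ◂ word p ▸ rs)

  -- The ladder displacement z − origin is only meaningful modulo r.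
  SameDisplacement : ℕ → ℕ → ℕ → Set
  SameDisplacement p₀ p z = ∃₂ λ a b → p + origin + a * r ≡ p₀ + z + b * r

  module _ (i₀ p₀ : ℕ) (s₀ : Bool) (c : ℕ) where

    data Tracks (i p : ℕ) : Zipper → ℕ → Zipper → ℕ → Set where
      tracks : ∀ {X y Z z} → Focus rows i X → i + origin ≡ i₀ + y →
        Around p Z → SameDisplacement p₀ p z → Tracks i p X y Z z

    Continues : ℕ → Coord → Set
    Continues k (i , p , s) = ∃ λ X → ∃ λ y → ∃ λ Z → ∃ λ z → Tracks i p X y Z z × T (walks c s₀ k X y Z z s)

    displace-right : ∀ {p p' z} → NextLadder r p p' → SameDisplacement p₀ p z → SameDisplacement p₀ p' (suc z)
    displace-right {p} {z = z} (inj₁ (refl , _)) (a , b , eq) = a , b , trans (cong suc eq) (lemma p₀ z (b * r))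
      where
      lemma : ∀ u v w → suc (u + v + w) ≡ u + suc v + w
      lemma = solve-∀
    -- Passing from ladder r - 1 to ladder 0 lowers the index by r - 1 instead of raising it by 1;
    -- one more multiple of r on the left makes up for this. `displace-left` adds it on the right.
    displace-right {p} {z = z} (inj₂ (refl , refl)) (a , b , eq) = suc a , b ,
      trans (trans (lemma p (a * r)) (cong suc eq)) (lemma′ p₀ z (b * r))
      where
      lemma : ∀ u w → 7 + (suc u + w) ≡ suc (u + 7 + w)
      lemma = solve-∀
      lemma′ : ∀ u v w → suc (u + v + w) ≡ u + suc v + w
      lemma′ = solve-∀

    displace-left : ∀ {p p' z} → NextLadder r p' p → SameDisplacement p₀ p (suc z) → SameDisplacement p₀ p' z
    displace-left {p' = p'} {z} (inj₁ (refl , _)) (a , b , eq) = a , b , suc-injective (trans eq (lemma p₀ z (b * r)))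
      where
      lemma : ∀ u v w → u + suc v + w ≡ suc (u + v + w)
      lemma = solve-∀
    displace-left {p' = p'} {z} (inj₂ (refl , refl)) (a , b , eq) = a , suc b ,
      trans (lemma p' (a * r)) (trans (cong (p' +_) eq) (lemma′ p' p₀ z (b * r)))
      where
      lemma : ∀ u w → u + 7 + w ≡ u + (7 + w)
      lemma = solve-∀
      lemma′ : ∀ t u v w → t + (u + suc v + w) ≡ u + v + (suc t + w)
      lemma′ = solve-∀

    cross-right : ∀ {k i p p' X y Z z} → NextLadder r p p' → Tracks i p X y Z z →
      T (cross c s₀ k X y Z z true) → Continues k (i , p' , false)
    cross-right {k} {p = p} {p'} {X} {y} {z = z} n (tracks f ey (around {ls} {[]} bh ah) d) ok =
      _ , _ , _ , _ , tracks f ey (around (n ∷ bh) []) (displace-right n d) ,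
      modusPonens (word p ⟶ word p')
        (all-elim (tryRight c s₀ k X y ls (word p) z) ok (∈-upTo⁺ (word-bound p'))) (word-next n)
    cross-right n (tracks f ey (around bh (n' ∷ ah)) d) ok with NextLadder-functional n n'
    ... | refl = _ , _ , _ , _ , tracks f ey (around (n ∷ bh) ah) (displace-right n d) , ok

    cross-left : ∀ {k i p p' X y Z z} → NextLadder r p' p → Tracks i p X y Z z →
      T (cross c s₀ k X y Z z false) → Continues k (i , p' , true)
    cross-left {k} {p = p} {p'} {X} {y} {z = suc z} n (tracks f ey (around {[]} {rs} bh ah) d) ok =
      _ , _ , _ , _ , tracks f ey (around [] (n ∷ ah)) (displace-left n d) ,
      modusPonens (word p' ⟶ word p)
        (all-elim (tryLeft c s₀ k X y (word p) rs z) ok (∈-upTo⁺ (word-bound p'))) (word-next n)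
    cross-left {z = suc z} n (tracks f ey (around (n' ∷ bh) ah) d) ok with NextLadder-injective n n'
    ... | refl = _ , _ , _ , _ , tracks f ey (around bh (n ∷ ah)) (displace-left n d) , ok

    -- In row 0 the zipper has nothing below, so `goDown` is `cross`. In row ℓ + 1 it has nothing
    -- above, by the length of `rows`, so `goUp` is `cross`.
    at-end : ∀ {k i p X y Z z s} → i ≡ 0 ⊎ i ≡ suc ℓ → Tracks i p X y Z z →
      T (goUp c s₀ k X y Z z s) → T (goDown c s₀ k X y Z z s) → T (cross c s₀ k X y Z z s)
    at-end (inj₁ refl) (tracks (start _) _ _ _) _ ok = ok
    at-end (inj₂ refl) (tracks {X = bs ◂ x ▸ []} f _ _ _) ok _ = ok
    at-end (inj₂ refl) (tracks {X = bs ◂ x ▸ x' ∷ as} f _ _ _) _ _ =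
      ⊥-elim (too-long (trans (focus-length f) rows-length))
      where
      too-long : ∀ {n} → ¬ (suc ℓ + suc (suc n) ≡ ℓ + 2)
      too-long {n} eq = <-irrefl (sym eq) (s≤s (+-monoʳ-≤ ℓ {2} (s≤s (s≤s z≤n))))

    advance : ∀ {k i p s q X y Z z} → Move ℓ r (i , p , s) q → Tracks i p X y Z z → T (moves c s₀ (suc k) X y Z z s) → Continues k q
    advance {k} {s = s} {X = X} {y} {Z} {z} m t ok
      with ∧-elim (walks c s₀ k X y Z z (not s)) ok
    ... | okF , ok′ with ∧-elim (goUp c s₀ k X y Z z s) ok′
    ... | okU , okD = go m t okF okU okD
      where
      go : ∀ {i p s q X y Z z} → Move ℓ r (i , p , s) q → Tracks i p X y Z z → T (walks c s₀ k X y Z z (not s)) →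
        T (goUp c s₀ k X y Z z s) → T (goDown c s₀ k X y Z z s) → Continues k q
      go flip (tracks f ey ar d) okF _ _ = _ , _ , _ , _ , tracks f ey ar d , okF
      go (up i<) (tracks {X = bs ◂ x ▸ []} f ey ar d) _ _ _ =
        ⊥-elim (<-irrefl (trans (sym (+-comm _ 1)) (trans (focus-length f) rows-length)) i<)
      go (up i<) (tracks {X = bs ◂ x ▸ x' ∷ as} {y = y} f ey ar d) _ okU _ =
        _ , _ , _ , _ , tracks (next f) (trans (cong suc ey) (sym (+-suc i₀ y))) ar d , okU
      go down (tracks {y = suc y} (next f) ey ar d) _ _ okD =
        _ , _ , _ , _ , tracks f (suc-injective (trans ey (+-suc i₀ y))) ar d , okD
      go (right e n) t _ okU okD = cross-right n t (at-end e t okU okD)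
      go (left e n) t _ okU okD = cross-left n t (at-end e t okU okD)

    -- Rows do not wrap around, so equal counters give equal rows. Ladder indices are only known
    -- modulo r, which suffices since both are below r.
    atStart-sound : ∀ {i p s X y Z z} → p < r → p₀ < r → Tracks i p X y Z z →
      T (atStart c s₀ y z s) → (i , p , s) ≡ (i₀ , p₀ , s₀)
    atStart-sound {i} {p} {s} {y = y} {z = z} p< p₀< (tracks _ ey _ (a , b , ep)) ok
      with ∧-elim (y ≡ᵇ origin) ok
    ... | y≡ , ok′ with ∧-elim (s ≡ˢ s₀) ok′
    ... | s≡ , z≡ = cong₂ _,_ i≡ (cong₂ _,_ p≡ (≡ˢ-sound s s₀ s≡))
      where
      i≡ : i ≡ i₀
      i≡ = +-cancelʳ-≡ origin i i₀ (trans ey (cong (i₀ +_) (≡ᵇ⇒≡ y origin y≡)))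
      lemma : ∀ u a w r → u + 7 + a * r + w * r ≡ 7 + (u + (a + w) * r)
      lemma = solve-∀
      same : ∀ u v → z + u * r ≡ origin + v * r → p ≡ p₀
      same u v eq = residue-unique (a + u) (b + v) p< p₀< (+-cancelˡ-≡ 7 _ _ (begin
        7 + (p + (a + u) * r)        ≡⟨ lemma p a u r ⟨
        p + 7 + a * r + u * r        ≡⟨ cong (_+ u * r) ep ⟩
        p₀ + z + b * r + u * r       ≡⟨ shuffle p₀ z b u r ⟩
        p₀ + b * r + (z + u * r)     ≡⟨ cong (p₀ + b * r +_) eq ⟩
        p₀ + b * r + (origin + v * r) ≡⟨ shuffle′ p₀ b v r ⟩
        7 + (p₀ + (b + v) * r)       ∎))
        where
        open ≡-Reasoning
        shuffle : ∀ p z b u r → p + z + b * r + u * r ≡ p + b * r + (z + u * r)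
        shuffle = solve-∀
        shuffle′ : ∀ p b v r → p + b * r + (7 + v * r) ≡ 7 + (p + (b + v) * r)
        shuffle′ = solve-∀
      p≡ : p ≡ p₀
      p≡ with ∨-elim (z ≡ᵇ origin) z≡ | period-∣
      ... | inj₁ e | _ = same 0 0 (cong (_+ 0) (≡ᵇ⇒≡ z origin e))
      ... | inj₂ e | w , w≡ with ∨-elim (z ≡ᵇ origin + period) e
      ... | inj₁ e′ = same 0 w (trans (+-identityʳ z) (trans (≡ᵇ⇒≡ z _ e′) (cong (origin +_) w≡)))
      ... | inj₂ e′ = same w 0 (trans (cong (z +_) (sym w≡)) (≡ᵇ⇒≡ (z + period) origin e′))

    here-sound : ∀ {k X y Z z} (v : HVert ℓ r) → let (i , p , s) = coord {ℓ} {r} v in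
      p₀ < r → colour v ≡ c → Tracks i p X y Z z → T (walks c s₀ k X y Z z s) → coord {ℓ} {r} v ≡ (i₀ , p₀ , s₀)
    here-sound {k} {z = z} (i , j) p₀< cv t@(tracks {X = bs ◂ x ▸ as} {y} f _ (around {ls} {rs} _ _) _) ok =
      atStart-sound (ladder-bound {r} (toℕ j) (toℕ<n j)) p₀< t
        (modusPonens (cell x (word p) s ≡ᵇ c) (proj₁ (∧-elim (not (cell x (word p) s ≡ᵇ c) ∨ atStart c s₀ y z s) ok))
          (≡⇒≡ᵇ _ _ (trans (cong (λ x → cell x (word p) s) (sym x≡)) cv)))
      where
      p = proj₁ (ladderSide (toℕ j))
      s = proj₂ (ladderSide (toℕ j))
      x≡ : rowAt rows (toℕ i) ≡ x
      x≡ = trans (cong (rowAt rows) (sym (+-identityʳ (toℕ i)))) (focus-rowAt f 0)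

    later : ∀ {k X y Z z s} → T (walks c s₀ k X y Z z s) → T (moves c s₀ k X y Z z s)
    later {k} {bs ◂ x ▸ as} {y} {ls ◂ t ▸ rs} {z} {s} ok =
      proj₂ (∧-elim (not (cell x t s ≡ᵇ c) ∨ atStart c s₀ y z s) ok)

    -- Induction on the walk. As `walks` tests the current cell before every move, walks shorter
    -- than the bound are covered as well.
    walk-sound : ∀ {u v k m X y Z z} → let (i , p , s) = coord {ℓ} {r} u in
      m ≤ k → Walk (H ℓ r) u v m → p₀ < r → colour v ≡ c →
      Tracks i p X y Z z → T (walks c s₀ k X y Z z s) → coord {ℓ} {r} v ≡ (i₀ , p₀ , s₀)
    walk-sound {u} {k = k} _ here p₀< cv t ok = here-sound {k} u p₀< cv t ok
    walk-sound {u} {k = suc k} {X = X} {y} {Z} {z} (s≤s m≤k) (step e w) p₀< cv t ok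
      with advance {k} (step-move e) t (later {suc k} {X} {y} {Z} {z} {proj₂ (proj₂ (coord {ℓ} {r} u))} ok)
    ... | _ , _ , _ , _ , t′ , ok′ = walk-sound m≤k w p₀< cv t′ ok′

  sweep-row : ∀ {i bs x as} → T (sweep [] rows) → Focus rows i (bs ◂ x ▸ as) → T (sweep bs (x ∷ as))
  sweep-row ok (start refl) = ok
  sweep-row ok (next {bs = bs} {x} {x'} {as} f) = proj₂ (∧-elim (rowOK (bs ◂ x ▸ x' ∷ as)) (sweep-row ok f))

  vertex-sound : T (sweep [] rows) → ∀ v → (1 ≤ colour v × colour v ≤ colours) ×
    (∀ u → colour u ≡ colour v → DistLe (H ℓ r) v u (colour v) → u ≡ v)
  vertex-sound ok v@(i , j) with focus rows (toℕ i) (subst (toℕ i <_) (sym rows-length) (toℕ<n i))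
  ... | (bs ◂ x ▸ as) , f = subst (λ c → (1 ≤ c × c ≤ colours) ×
      (∀ u → colour u ≡ c → DistLe (H ℓ r) v u c → u ≡ v)) (sym v≡) (bounds , separated)
    where
    p = proj₁ (ladderSide (toℕ j))
    s = proj₂ (ladderSide (toℕ j))
    c = cell x (word p) s
    v≡ : colour v ≡ c
    v≡ = cong (λ x → cell x (word p) s) (trans (cong (rowAt rows) (sym (+-identityʳ (toℕ i)))) (focus-rowAt f 0))
    both : ℕ → Bool
    both t = cellOK (cell x t false) (bs ◂ x ▸ as) t false ∧ cellOK (cell x t true) (bs ◂ x ▸ as) t true
    side : ∀ s → T (both (word p)) → T (cellOK (cell x (word p) s) (bs ◂ x ▸ as) (word p) s)
    side false = proj₁ ∘ ∧-elim (cellOK (cell x (word p) false) (bs ◂ x ▸ as) (word p) false)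
    side true = proj₂ ∘ ∧-elim (cellOK (cell x (word p) false) (bs ◂ x ▸ as) (word p) false)
    okCell : T (cellOK c (bs ◂ x ▸ as) (word p) s)
    okCell = side s (all-elim both (proj₁ (∧-elim (rowOK (bs ◂ x ▸ as)) (sweep-row ok f))) (∈-upTo⁺ (word-bound p)))
    okRest = proj₂ (∧-elim (1 ≤ᵇ c) okCell)
    bounds : 1 ≤ c × c ≤ colours
    bounds = ≤ᵇ⇒≤ 1 c (proj₁ (∧-elim (1 ≤ᵇ c) okCell)) , ≤ᵇ⇒≤ c colours (proj₁ (∧-elim (c ≤ᵇ colours) okRest))
    separated : ∀ u → colour u ≡ c → DistLe (H ℓ r) v u c → u ≡ v
    separated u cu (m , m≤c , w) = coord-injective {ℓ} {r} u v
      (walk-sound (toℕ i) p s c m≤c w (ladder-bound {r} (toℕ j) (toℕ<n j)) cu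
        (tracks f refl (around [] []) (0 , 0 , refl)) (proj₂ (∧-elim (c ≤ᵇ colours) okRest)))

  packing : T (sweep [] rows) → HasPackingColouring (H ℓ r) colours
  packing ok = colour , (λ v → proj₁ (vertex-sound ok v)) ,
    λ { u v i u≢v refl cv d → u≢v (sym (proj₂ (vertex-sound ok u) v cv d)) }

-- The colourings

alternate : ℕ → ℕ
alternate 0 = 0
alternate 1 = 1
alternate (suc (suc p)) = alternate p

alternate-bound : ∀ p → alternate p < 2
alternate-bound 0 = s≤s z≤n
alternate-bound 1 = s≤s (s≤s z≤n)
alternate-bound (suc (suc p)) = alternate-bound p

alternate-linked : (_∼_ : ℕ → ℕ → Set) → 0 ∼ 1 → 1 ∼ 0 → ∀ p → alternate p ∼ alternate (suc p)
alternate-linked _∼_ a b 0 = a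
alternate-linked _∼_ a b 1 = b
alternate-linked _∼_ a b (suc (suc p)) = alternate-linked _∼_ a b p

alternate-1+2* : ∀ m → alternate (suc (2 * m)) ≡ 1
alternate-1+2* zero = refl
alternate-1+2* (suc m) rewrite +-suc m (m + 0) = alternate-1+2* m

alternate-odd : ∀ {p} m → suc p ≡ 2 * m → alternate p ≡ 1
alternate-odd (suc m) refl rewrite +-suc m (m + 0) = alternate-1+2* m

spell : List ℕ → ℕ → ℕ
spell [] p = alternate p
spell (t ∷ ts) zero = t
spell (t ∷ ts) (suc p) = spell ts p

evenPattern : Pattern
evenPattern = record { colours = 5 ; types = 2 ; period = 0 ; successors = λ { 0 → 1 ∷ [] ; _ → 0 ∷ [] } }

evenWord : ∀ m → Word evenPattern (2 * m)
evenWord m = record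
  { word = alternate
  ; word-bound = alternate-bound
  ; word-next = linked
  ; period-∣ = 0 , refl
  }
  where
  _∼_ : ℕ → ℕ → Set
  t ∼ t' = T (Check._⟶_ evenPattern t t')
  linked : ∀ {p p'} → NextLadder (2 * m) p p' → alternate p ∼ alternate p'
  linked {p} (inj₁ (refl , _)) = alternate-linked _∼_ tt tt p
  -- Evenness of the ring enters here: the last ladder has odd index, hence type 1, and may precede
  -- type 0.
  linked (inj₂ (eq , refl)) rewrite alternate-odd m eq = tt

-- Types 2, …, n spell the irregular ladders, which are followed by an alternating word in the types 0 and 1.
spliced : ℕ → ℕ → List ℕ
spliced n 0 = 1 ∷ []
spliced n 1 = 0 ∷ 2 ∷ []
spliced n t = if t ≡ᵇ n then 0 ∷ 2 ∷ [] else suc t ∷ []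

-- For ℓ = r = 3 colour 6 is needed on the rings, which have length 6: only there do walks that go once around matter.
odd₃Pattern odd₅Pattern triplePattern : Pattern
odd₃Pattern = record { colours = 6 ; types = 5 ; period = 0 ; successors = spliced 4 }
odd₅Pattern = record { colours = 6 ; types = 7 ; period = 0 ; successors = spliced 6 }
triplePattern = record { colours = 6 ; types = 3 ; period = 3 ; successors = λ { 0 → 1 ∷ [] ; 1 → 2 ∷ [] ; _ → 0 ∷ [] } }

odd₃Word : ∀ m → Word odd₃Pattern (3 + 2 * m)
odd₃Word m = record
  { word = word
  ; word-bound = bound
  ; word-next = linked
  ; period-∣ = 0 , refl
  }
  where
  word : ℕ → ℕ
  word = spell (2 ∷ 3 ∷ 4 ∷ [])
  _∼_ : ℕ → ℕ → Set
  t ∼ t' = T (Check._⟶_ odd₃Pattern t t')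
  bound : ∀ p → word p < 5
  bound 0 = ≤ᵇ⇒≤ 3 5 tt
  bound 1 = ≤ᵇ⇒≤ 4 5 tt
  bound 2 = ≤ᵇ⇒≤ 5 5 tt
  bound (suc (suc (suc p))) = ≤-trans (alternate-bound p) (≤ᵇ⇒≤ 2 5 tt)
  consecutive : ∀ p → word p ∼ word (suc p)
  consecutive 0 = tt
  consecutive 1 = tt
  consecutive 2 = tt
  consecutive (suc (suc (suc p))) = alternate-linked _∼_ tt tt p
  -- The ring closes after the last irregular ladder if m = 0 and after a ladder of type 1
  -- otherwise; both may precede type 2.
  closing : ∀ m → word (2 + 2 * m) ∼ 2
  closing zero = tt
  closing (suc m) rewrite alternate-odd (suc m) refl = tt
  linked : ∀ {p p'} → NextLadder (3 + 2 * m) p p' → word p ∼ word p'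
  linked {p} (inj₁ (refl , _)) = consecutive p
  linked (inj₂ (refl , refl)) = closing m

odd₅Word : ∀ m → Word odd₅Pattern (5 + 2 * m)
odd₅Word m = record
  { word = word
  ; word-bound = bound
  ; word-next = linked
  ; period-∣ = 0 , refl
  }
  where
  word : ℕ → ℕ
  word = spell (2 ∷ 3 ∷ 4 ∷ 5 ∷ 6 ∷ [])
  _∼_ : ℕ → ℕ → Set
  t ∼ t' = T (Check._⟶_ odd₅Pattern t t')
  bound : ∀ p → word p < 7
  bound 0 = ≤ᵇ⇒≤ 3 7 tt
  bound 1 = ≤ᵇ⇒≤ 4 7 tt
  bound 2 = ≤ᵇ⇒≤ 5 7 tt
  bound 3 = ≤ᵇ⇒≤ 6 7 tt
  bound 4 = ≤ᵇ⇒≤ 7 7 tt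
  bound (suc (suc (suc (suc (suc p))))) = ≤-trans (alternate-bound p) (≤ᵇ⇒≤ 2 7 tt)
  consecutive : ∀ p → word p ∼ word (suc p)
  consecutive 0 = tt
  consecutive 1 = tt
  consecutive 2 = tt
  consecutive 3 = tt
  consecutive 4 = tt
  consecutive (suc (suc (suc (suc (suc p))))) = alternate-linked _∼_ tt tt p
  closing : ∀ m → word (4 + 2 * m) ∼ 2
  closing zero = tt
  closing (suc m) rewrite alternate-odd (suc m) refl = tt
  linked : ∀ {p p'} → NextLadder (5 + 2 * m) p p' → word p ∼ word p'
  linked {p} (inj₁ (refl , _)) = consecutive p
  linked (inj₂ (refl , refl)) = closing m

tripleWord : Word triplePattern 3
tripleWord = record
  { word = word
  ; word-bound = bound
  ; word-next = linked
  ; period-∣ = 1 , refl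
  }
  where
  word : ℕ → ℕ
  word 0 = 0
  word 1 = 1
  word _ = 2
  bound : ∀ p → word p < 3
  bound 0 = ≤ᵇ⇒≤ 1 3 tt
  bound 1 = ≤ᵇ⇒≤ 2 3 tt
  bound (suc (suc p)) = ≤-refl
  linked : ∀ {p p'} → NextLadder 3 p p' → T (Check._⟶_ triplePattern (word p) (word p'))
  linked {0} (inj₁ (refl , _)) = tt
  linked {1} (inj₁ (refl , _)) = tt
  linked {suc (suc p)} (inj₁ (refl , s≤s (s≤s (s≤s ()))))
  linked (inj₂ (refl , refl)) = tt

-- Ten digits describe the five types of `odd₃Pattern`. As `evenPattern` reads only the last four,
-- and these avoid 6, the same rows serve even and odd r.
block : List ℕ
block =
  4131514151 ∷ 1212131213 ∷ 3151213121 ∷ 1513141514 ∷ 2121312131 ∷ 1314121312 ∷ []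

suffix : List ℕ
suffix =
  4131614151 ∷ 1215131213 ∷ []

-- The lengths 4, 6, 7, 8, 9 and 11 represent every residue modulo 6. With the two rows of `suffix`
-- a prefix and k blocks give height ℓ = 6k + length; among ℓ ≥ 3 this misses only 3 and 5.
prefix : Fin 6 → List ℕ
prefix 0F =
  3151213121 ∷ 1613141514 ∷ 2121312131 ∷ 1314121312 ∷ []
prefix 1F =
  2141312131 ∷ 1312151415 ∷ 6151213121 ∷ 1213131214 ∷ 5121415131 ∷ 1314121312 ∷ []
prefix 2F =
  1413121312 ∷ 3121514151 ∷ 1216131213 ∷ 5151213121 ∷ 1613141514 ∷ 2121312131 ∷
  1314121312 ∷ []
prefix 3F =
  3121413121 ∷ 1513121514 ∷ 2161312131 ∷ 1312151415 ∷ 6151213121 ∷ 1213131213 ∷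
  5121415141 ∷ 1314121312 ∷ []
prefix 4F =
  1512131213 ∷ 2131415141 ∷ 1316121312 ∷ 4141512151 ∷ 1212131413 ∷ 3151213121 ∷
  1513141514 ∷ 2121312131 ∷ 1314121312 ∷ []
prefix 5F =
  1413121312 ∷ 3121614151 ∷ 1215131213 ∷ 5131413141 ∷ 1312121512 ∷ 2141512131 ∷
  1416131415 ∷ 3151213121 ∷ 1513141214 ∷ 2121315131 ∷ 1314121312 ∷ []

evenRows₃ : List ℕ
evenRows₃ = 3121 ∷ 1514 ∷ 2131 ∷ 1415 ∷ 3121 ∷ []

oddRows₃ : List ℕ
oddRows₃ =
  32162151213121 ∷ 15411313141514 ∷ 21324121312131 ∷ 14151214121415 ∷ 31213161513121 ∷ []

tripleRows₃ : List ℕ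
tripleRows₃ = 215216 ∷ 131341 ∷ 412132 ∷ 121415 ∷ 316121 ∷ []

blocks : ℕ → List ℕ
blocks zero = suffix
blocks (suc k) = block ++ blocks k

-- Sweeps over repeated blocks

module Periodic (P : Pattern) where
  open Check P

  -- Only the next rows are checked, but those behind them stay in view and may end in a variable.
  scan : ℕ → List ℕ → List ℕ → Bool
  scan zero bs as = true
  scan (suc n) bs [] = true
  scan (suc n) bs (x ∷ as) = rowOK (bs ◂ x ▸ as) ∧ scan n (x ∷ bs) as

  sweep-++ : ∀ xs {bs as} → T (scan (length xs) bs (xs ++ as)) → T (sweep (xs ʳ++ bs) as) → T (sweep bs (xs ++ as))
  sweep-++ [] _ ok = ok
  sweep-++ (x ∷ xs) {bs} {as} sc ok with ∧-elim (rowOK (bs ◂ x ▸ xs ++ as)) sc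
  ... | okRow , sc′ = Equivalence.from T-∧ (okRow , sweep-++ xs sc′ ok)

  -- Walks have length at most 6, the height of a block, so they never see past the next block.
  BlockOK : Set
  BlockOK = ∀ bs → T (sweep (block ʳ++ bs) suffix) ×
                   T (scan 6 (block ʳ++ bs) (block ++ suffix)) ×
                   (∀ as → T (scan 6 (block ʳ++ bs) (block ++ block ++ as)))

  sweep-blocks : BlockOK → ∀ k bs → T (sweep (block ʳ++ bs) (blocks k))
  sweep-blocks ok zero bs = proj₁ (ok bs)
  sweep-blocks ok (suc zero) bs = sweep-++ block (proj₁ (proj₂ (ok bs))) (sweep-blocks ok 0 (block ʳ++ bs))
  sweep-blocks ok (suc (suc k)) bs = sweep-++ block (proj₂ (proj₂ (ok bs)) (blocks k)) (sweep-blocks ok (suc k) (block ʳ++ bs))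

  -- The cases of no, one and at least two blocks. In the last, the second block hides the unknown
  -- rest from every checked row.
  PrefixOK : List ℕ → Set
  PrefixOK xs = T (sweep [] (xs ++ suffix)) ×
                T (scan (length xs) [] (xs ++ block ++ suffix)) ×
                T (scan 6 (xs ʳ++ []) (block ++ suffix)) ×
                (∀ as → T (scan (length xs) [] (xs ++ block ++ block ++ as)) ×
                        T (scan 6 (xs ʳ++ []) (block ++ block ++ as)))

  sweep-periodic : BlockOK → ∀ xs → PrefixOK xs → ∀ k → T (sweep [] (xs ++ blocks k))
  sweep-periodic ok xs (ok₀ , _) zero = ok₀
  sweep-periodic ok xs (_ , ok₁ , ok₂ , _) (suc zero) =
    sweep-++ xs ok₁ (sweep-++ block ok₂ (sweep-blocks ok 0 (xs ʳ++ [])))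
  sweep-periodic ok xs (_ , _ , _ , ok₃) (suc (suc k)) =
    sweep-++ xs (proj₁ (ok₃ (blocks k))) (sweep-++ block (proj₂ (ok₃ (blocks k))) (sweep-blocks ok (suc k) (xs ʳ++ [])))

-- The check evaluates to `true` with `bs` and the rest as free variables, because no walk gets far
-- enough to inspect them.
block-even : Periodic.BlockOK evenPattern
block-even bs = tt , tt , λ _ → tt

block-odd : Periodic.BlockOK odd₃Pattern
block-odd bs = tt , tt , λ _ → tt

prefix-even : ∀ c → Periodic.PrefixOK evenPattern (prefix c)
prefix-even 0F = tt , tt , tt , λ _ → tt , tt
prefix-even 1F = tt , tt , tt , λ _ → tt , tt
prefix-even 2F = tt , tt , tt , λ _ → tt , tt
prefix-even 3F = tt , tt , tt , λ _ → tt , tt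
prefix-even 4F = tt , tt , tt , λ _ → tt , tt
prefix-even 5F = tt , tt , tt , λ _ → tt , tt

prefix-odd : ∀ c → Periodic.PrefixOK odd₃Pattern (prefix c)
prefix-odd 0F = tt , tt , tt , λ _ → tt , tt
prefix-odd 1F = tt , tt , tt , λ _ → tt , tt
prefix-odd 2F = tt , tt , tt , λ _ → tt , tt
prefix-odd 3F = tt , tt , tt , λ _ → tt , tt
prefix-odd 4F = tt , tt , tt , λ _ → tt , tt
prefix-odd 5F = tt , tt , tt , λ _ → tt , tt

Periodic-height : ℕ → Set
Periodic-height ℓ = ∃ λ c → ∃ λ k → ℓ ≡ 6 * k + length (prefix c)

periodic-height : ∀ n → Periodic-height (6 + n)
periodic-height 0 = 1F , 0 , refl
periodic-height 1 = 2F , 0 , refl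
periodic-height 2 = 3F , 0 , refl
periodic-height 3 = 4F , 0 , refl
periodic-height 4 = 0F , 1 , refl
periodic-height 5 = 5F , 0 , refl
periodic-height (suc (suc (suc (suc (suc (suc n)))))) with periodic-height n
... | c , k , eq = c , suc k , trans (cong (6 +_) eq) (trans (sym (+-assoc 6 (6 * k) _)) (cong (_+ length (prefix c)) (sym (*-suc 6 k))))

height-cases : ∀ ℓ → 3 ≤ ℓ → ¬ (ℓ ≡ 5) → (ℓ ≡ 3) ⊎ Periodic-height ℓ
height-cases 0 () _
height-cases 1 (s≤s ()) _
height-cases 2 (s≤s (s≤s ())) _
height-cases 3 _ _ = inj₁ refl
height-cases 4 _ _ = inj₂ (0F , 0 , refl)
height-cases 5 _ ℓ≢5 = ⊥-elim (ℓ≢5 refl)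
height-cases (suc (suc (suc (suc (suc (suc n)))))) _ _ = inj₂ (periodic-height n)

length-blocks : ∀ k → length (blocks k) ≡ 6 * k + 2
length-blocks zero = refl
length-blocks (suc k) = trans (cong (6 +_) (length-blocks k)) (trans (sym (+-assoc 6 (6 * k) 2)) (cong (_+ 2) (sym (*-suc 6 k))))

length-periodic : ∀ xs k → length (xs ++ blocks k) ≡ 6 * k + length xs + 2
length-periodic xs k = begin
  length (xs ++ blocks k)       ≡⟨ length-++ xs ⟩
  length xs + length (blocks k) ≡⟨ cong (length xs +_) (length-blocks k) ⟩
  length xs + (6 * k + 2)       ≡⟨ +-assoc (length xs) (6 * k) 2 ⟨
  length xs + 6 * k + 2         ≡⟨ cong (_+ 2) (+-comm (length xs) (6 * k)) ⟩
  6 * k + length xs + 2         ∎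
  where open ≡-Reasoning

even-colouring : ∀ ℓ m → 3 ≤ ℓ → ¬ (ℓ ≡ 5) → HasPackingColouring (H ℓ (2 * m)) 5
even-colouring ℓ m 3≤ℓ ℓ≢5 with height-cases ℓ 3≤ℓ ℓ≢5
... | inj₁ refl = Soundness.packing evenPattern (evenWord m) 3 evenRows₃ refl tt
... | inj₂ (c , k , refl) =
  Soundness.packing evenPattern (evenWord m) ℓ (prefix c ++ blocks k) (length-periodic (prefix c) k)
    (Periodic.sweep-periodic evenPattern block-even (prefix c) (prefix-even c) k)

odd-colouring : ∀ ℓ m → 3 ≤ ℓ → ¬ (ℓ ≡ 5) → HasPackingColouring (H ℓ (3 + 2 * m)) 6
odd-colouring ℓ m 3≤ℓ ℓ≢5 with height-cases ℓ 3≤ℓ ℓ≢5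
odd-colouring ℓ zero 3≤ℓ ℓ≢5 | inj₁ refl = Soundness.packing triplePattern tripleWord 3 tripleRows₃ refl tt
odd-colouring ℓ (suc m) 3≤ℓ ℓ≢5 | inj₁ refl =
  subst (λ r → HasPackingColouring (H 3 r) 6) (cong (3 +_) (sym (*-suc 2 m)))
    (Soundness.packing odd₅Pattern (odd₅Word m) 3 oddRows₃ refl tt)
... | inj₂ (c , k , refl) =
  Soundness.packing odd₃Pattern (odd₃Word m) ℓ (prefix c ++ blocks k) (length-periodic (prefix c) k)
    (Periodic.sweep-periodic odd₃Pattern block-odd (prefix c) (prefix-odd c) k)

-- Refuting colourings of windows

Adj-sym : ∀ {ℓ r} {u v : HVert ℓ r} → Adj (H ℓ r) u v → Adj (H ℓ r) v u
Adj-sym (inj₁ e) = inj₂ e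
Adj-sym (inj₂ e) = inj₁ e

_◅◅_ : ∀ {G u v w a b} → Walk G u v a → Walk G v w b → Walk G u w (a + b)
here ◅◅ W = W
step e V ◅◅ W = step e (V ◅◅ W)

reverse-walk : ∀ {ℓ r u v k} → Walk (H ℓ r) u v k → Walk (H ℓ r) v u k
reverse-walk here = here
reverse-walk {k = suc k} (step e W) = subst (Walk _ _ _) (+-comm k 1) (reverse-walk W ◅◅ step (Adj-sym e) here)

-- (i , t , s) stands for the vertex in row i at side s of the t-th ladder of a window.
distance : Coord → Coord → ℕ
distance (i , t , s) (i' , t' , s') =
  if t ≡ᵇ t' then (i ∸ i') + (i' ∸ i) + (if s ≡ˢ s' then 0 else 1)
  else i + i' + ((column (t , s) ∸ column (t' , s')) + (column (t' , s') ∸ column (t , s)))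

module Refutation (height width : ℕ) where
  inside : Coord → Bool
  inside (i , t , _) = (i <ᵇ height) ∧ (t <ᵇ width)

  between : ℕ → ℕ → Bool
  between d c = (1 ≤ᵇ d) ∧ (d ≤ᵇ c)

  clash : Coord → ℕ → Coord × ℕ → Bool
  clash q c (q' , c') = (c ≡ᵇ c') ∧ between (distance q q') c

  -- Backtracking: each vertex in turn receives every colour of its list, and a branch closes at its
  -- first clash. A branch that survives all tasks yields `false`.
  refute : List (Coord × List ℕ) → List (Coord × ℕ) → Bool
  try : List (Coord × List ℕ) → List (Coord × ℕ) → Coord → ℕ → Bool
  refute [] _ = false
  refute ((q , cs) ∷ tasks) done = inside q ∧ all (try tasks done q) cs
  try tasks done q c = any (clash q c) done ∨ refute tasks ((q , c) ∷ done)

  any-elim : ∀ {A : Set} (f : A → Bool) {Q : A → Set} {xs} → All Q xs → T (any f xs) → ∃ λ x → Q x × T (f x)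
  any-elim f (_∷_ {x} q qs) ok with ∨-elim (f x) ok
  ... | inj₁ fx = x , q , fx
  ... | inj₂ rest = any-elim f qs rest

  module _ (γ : Coord → ℕ)
           (separated : ∀ q q' → T (inside q) → T (inside q') → γ q ≡ γ q' → 1 ≤ distance q q' → ¬ distance q q' ≤ γ q) where

    -- The branch that follows γ never clashes, so it reaches the empty task list, where `refute` is
    -- `false`.
    refute-sound : ∀ {tasks done} → All (λ (q , cs) → γ q ∈ cs) tasks →
      All (λ (q , c) → T (inside q) × γ q ≡ c) done → ¬ T (refute tasks done)
    refute-sound {(q , cs) ∷ tasks} {done} (γq∈ ∷ γ∈) known ok with ∧-elim (inside q) ok
    ... | q-inside , tries with ∨-elim (any (clash q (γ q)) done) (all-elim (try tasks done q) tries γq∈)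
    ... | inj₂ later = refute-sound γ∈ ((q-inside , refl) ∷ known) later
    ... | inj₁ clashes with any-elim (clash q (γ q)) known clashes
    ... | (q' , c') , (q'-inside , refl) , cl with ∧-elim (γ q ≡ᵇ γ q') cl
    ... | same , near with ∧-elim (1 ≤ᵇ distance q q') near
    ... | pos , close = separated q q' q-inside q'-inside (≡ᵇ⇒≡ _ _ same) (≤ᵇ⇒≤ 1 _ pos) (≤ᵇ⇒≤ _ _ close)

-- The four searches

mirror : Coord → Coord
mirror (i , t , s) = i , 2 ∸ t , not s

palette : ℕ → List ℕ
palette K = map suc (upTo K)

mono : List ℕ → List Coord → List (Coord × List ℕ)
mono cs = map (_, cs)

-- These orders were found by local search, to keep the backtracking small.
order₄ : List Coord
order₄ = (0 , 0 , true) ∷ (0 , 1 , false) ∷ (0 , 0 , false) ∷ (1 , 0 , true) ∷ (1 , 0 , false) ∷ (2 , 0 , true) ∷ (2 , 0 , false) ∷ (0 , 1 , true) ∷ (1 , 1 , false) ∷ (1 , 1 , true) ∷ (2 , 1 , false) ∷ (2 , 1 , true) ∷ []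

orderRung : List Coord
orderRung = (1 , 1 , false) ∷ (0 , 0 , true) ∷ (1 , 1 , true) ∷ (2 , 1 , true) ∷ (2 , 1 , false) ∷ (1 , 0 , true) ∷ (0 , 0 , false) ∷ (0 , 2 , false) ∷ (0 , 2 , true) ∷ (1 , 2 , false) ∷ (1 , 0 , false) ∷ (1 , 2 , true) ∷ (2 , 2 , false) ∷ (2 , 0 , true) ∷ (3 , 1 , true) ∷ (3 , 1 , false) ∷ []

orderRim : List Coord
orderRim = (0 , 1 , true) ∷ (1 , 1 , false) ∷ (0 , 2 , true) ∷ (1 , 2 , false) ∷ (1 , 1 , true) ∷ (2 , 1 , true) ∷ (2 , 1 , false) ∷ (3 , 1 , false) ∷ []

-- Refuting these tasks forces colour 1 onto the bottom rung of the middle ladder.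
tasksRung : List (Coord × List ℕ)
tasksRung = ((0 , 1 , false) , 2 ∷ 3 ∷ 4 ∷ 5 ∷ []) ∷ ((0 , 1 , true) , 2 ∷ 3 ∷ 4 ∷ 5 ∷ []) ∷ mono (palette 5) orderRung

-- Refuting these tasks excludes 4 and 5 from the right end of a bottom rung when this rung and the
-- next two have their 1 on the left.
tasksLeft : List (Coord × List ℕ)
tasksLeft = ((0 , 0 , false) , 1 ∷ []) ∷ ((0 , 1 , false) , 1 ∷ []) ∷ ((0 , 2 , false) , 1 ∷ []) ∷
  ((0 , 0 , true) , 4 ∷ 5 ∷ []) ∷ mono (palette 5) orderRim

-- The image of `tasksLeft` under `mirror`.
tasksRight : List (Coord × List ℕ)
tasksRight = ((0 , 2 , true) , 1 ∷ []) ∷ ((0 , 1 , true) , 1 ∷ []) ∷ ((0 , 0 , true) , 1 ∷ []) ∷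
  ((0 , 2 , false) , 4 ∷ 5 ∷ []) ∷ mono (palette 5) (map mirror orderRim)

refutation₄ : T (Refutation.refute 3 2 (mono (palette 4) order₄) [])
refutation₄ = tt

refutationRung : T (Refutation.refute 4 3 tasksRung [])
refutationRung = tt

refutationLeft : T (Refutation.refute 4 3 tasksLeft [])
refutationLeft = tt

refutationRight : T (Refutation.refute 4 3 tasksRight [])
refutationRight = tt

-- Windows placed in the graph

ladderSide-column : ∀ q → ladderSide (column q) ≡ q
ladderSide-column (p , false) = ladderSide-2* p
ladderSide-column (p , true) = cong inc (ladderSide-2* p)

column-+ : ∀ t p s → column (t + p , s) ≡ 2 * p + column (t , s)
column-+ t p false = trans (*-distribˡ-+ 2 t p) (+-comm (2 * t) (2 * p))
column-+ t p true = trans (cong suc (column-+ t p false)) (sym (+-suc (2 * p) (2 * t)))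

column-bound : ∀ {t n} s → t < n → column (t , s) < 2 * n
column-bound {t} {n} s t<n = ≤-trans (upper s) (*-monoʳ-≤ 2 t<n)
  where
  upper : ∀ s → suc (column (t , s)) ≤ 2 * suc t
  upper false = subst (suc (2 * t) ≤_) (sym (*-suc 2 t)) (n≤1+n _)
  upper true = ≤-reflexive (sym (*-suc 2 t))

-- Cancelling b and the equal remainders leaves x and y congruent modulo n, and both are below n.
%-window-injective : ∀ {n b x y} .{{_ : NonZero n}} → x < n → y < n → (b + x) % n ≡ (b + y) % n → x ≡ y
%-window-injective {n} {b} {x} {y} x<n y<n eq =
  residue-unique ((b + y) / n) ((b + x) / n) x<n y<n (+-cancelˡ-≡ b _ _ (begin
    b + (x + (b + y) / n * n)                       ≡⟨ +-assoc b x _ ⟨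
    b + x + (b + y) / n * n                         ≡⟨ cong (_+ (b + y) / n * n) (m≡m%n+[m/n]*n (b + x) n) ⟩
    (b + x) % n + (b + x) / n * n + (b + y) / n * n ≡⟨ cong (λ ρ → ρ + (b + x) / n * n + (b + y) / n * n) eq ⟩
    (b + y) % n + (b + x) / n * n + (b + y) / n * n ≡⟨ swap ((b + y) % n) _ _ ⟩
    (b + y) % n + (b + y) / n * n + (b + x) / n * n ≡⟨ cong (_+ (b + x) / n * n) (m≡m%n+[m/n]*n (b + y) n) ⟨
    b + y + (b + x) / n * n                         ≡⟨ +-assoc b y _ ⟩
    b + (y + (b + x) / n * n)                       ∎))
  where
  open ≡-Reasoning
  swap : ∀ u v w → u + v + w ≡ u + w + v
  swap = solve-∀

module Windows (ℓ r : ℕ) (1≤r : 1 ≤ r) where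
  private instance
    2r≢0 : NonZero (2 * r)
    2r≢0 = >-nonZero (≤-trans (≤-trans 1≤r (m≤m+n r _)) ≤-refl)
    ℓ+2≢0 : NonZero (ℓ + 2)
    ℓ+2≢0 = >-nonZero (≤-trans (s≤s z≤n) (m≤n+m 2 ℓ))

  -- Columns are unrolled: x stands for x mod 2r (and i for i mod ℓ + 2, but only i < ℓ + 2 is used).
  node : ℕ → ℕ → HVert ℓ r
  node i x = fromℕ< (m%n<n i (ℓ + 2)) , fromℕ< (m%n<n x (2 * r))

  toℕ-row : ∀ {i} → i < ℓ + 2 → toℕ (proj₁ (node i 0)) ≡ i
  toℕ-row {i} i< = trans (toℕ-fromℕ< _) (m<n⇒m%n≡m i<)

  toℕ-column : ∀ x → toℕ (proj₂ (node 0 x)) ≡ x % (2 * r)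
  toℕ-column x = toℕ-fromℕ< _

  node-periodic : ∀ i x → node i (x + 2 * r) ≡ node i x
  node-periodic i x = cong (proj₁ (node i x) ,_)
    (toℕ-injective (trans (toℕ-column (x + 2 * r)) (trans ([m+n]%n≡m%n x (2 * r)) (sym (toℕ-column x)))))

  vertical : ∀ {i} x → suc i < ℓ + 2 → Adj (H ℓ r) (node i x) (node (suc i) x)
  vertical x i< = inj₁ (vert (trans (toℕ-row i<) (cong suc (sym (toℕ-row (<⇒≤ i<))))) refl)

  reduce-suc : ∀ x → suc x % (2 * r) ≡ suc (x % (2 * r)) % (2 * r)
  reduce-suc x = trans (cong (λ y → suc y % (2 * r)) (m≡m%n+[m/n]*n x (2 * r)))
    ([m+kn]%n≡m%n (suc (x % (2 * r))) (x / (2 * r)) (2 * r))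

  ring-succ : ∀ x → SuccMod r (x % (2 * r)) (suc x % (2 * r))
  ring-succ x with <-cmp (suc (x % (2 * r))) (2 * r)
  ... | tri< ρ+1<2r _ _ = inj₁ (trans (reduce-suc x) (m<n⇒m%n≡m ρ+1<2r))
  ... | tri≈ _ ρ+1≡2r _ = inj₂ (ρ+1≡2r , trans (reduce-suc x) (trans (cong (_% (2 * r)) ρ+1≡2r) (n%n≡0 (2 * r))))
  ... | tri> _ _ 2r<ρ+1 = ⊥-elim (<⇒≱ 2r<ρ+1 (m%n<n x (2 * r)))

  ring : ∀ x → Adj (H ℓ r) (node 0 x) (node 0 (suc x))
  ring x = inj₁ (ring0 (toℕ-row 0<) (toℕ-row 0<)
    (subst₂ (SuccMod r) (sym (toℕ-column x)) (sym (toℕ-column (suc x))) (ring-succ x)))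
    where
    0< : 0 < ℓ + 2
    0< = ≤-trans (s≤s z≤n) (m≤n+m 2 ℓ)

  crossbar : ∀ {i} p → i ≤ ℓ → Adj (H ℓ r) (node i (2 * p)) (node i (suc (2 * p)))
  -- Row 0 has no `rung` edges; there the bottom ring supplies the edge.
  crossbar {zero} p _ = ring (2 * p)
  crossbar {suc i} p i<ℓ = inj₁ (rung (p % r) (≤-trans (s≤s z≤n) (≤-reflexive (sym row≡)))
      (≤-trans (≤-reflexive row≡) i<ℓ) refl (even false) (even true))
    where
    row≡ : toℕ (proj₁ (node (suc i) 0)) ≡ suc i
    row≡ = toℕ-row (≤-trans (s≤s i<ℓ) (≤-trans (n≤1+n _) (≤-reflexive (+-comm 2 ℓ))))
    instance
      r≢0 : NonZero r
      r≢0 = >-nonZero 1≤r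
    unroll : ∀ s → column (p , s) ≡ column (p % r , s) + p / r * (2 * r)
    unroll s = begin
      column (p , s)                         ≡⟨ cong (λ q → column (q , s)) (m≡m%n+[m/n]*n p r) ⟩
      column (p % r + p / r * r , s)         ≡⟨ column-+ (p % r) (p / r * r) s ⟩
      2 * (p / r * r) + column (p % r , s)   ≡⟨ +-comm (2 * (p / r * r)) _ ⟩
      column (p % r , s) + 2 * (p / r * r)   ≡⟨ cong (column (p % r , s) +_) (lemma (p / r) r) ⟩
      column (p % r , s) + p / r * (2 * r)   ∎
      where
      open ≡-Reasoning
      lemma : ∀ a b → 2 * (a * b) ≡ a * (2 * b)
      lemma = solve-∀
    even : ∀ s → toℕ (proj₂ (node 0 (column (p , s)))) ≡ column (p % r , s)
    even s = trans (toℕ-column (column (p , s))) (trans (cong (_% (2 * r)) (unroll s))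
      (trans ([m+kn]%n≡m%n _ (p / r) (2 * r)) (m<n⇒m%n≡m (column-bound s (m%n<n p r)))))

  Near : HVert ℓ r → HVert ℓ r → ℕ → Set
  Near = DistLe (H ℓ r)

  near-refl : ∀ u → Near u u 0
  near-refl u = 0 , z≤n , here

  near-step : ∀ {u v} → Adj (H ℓ r) u v → Near u v 1
  near-step e = 1 , ≤-refl , step e here

  near-sym : ∀ {u v a} → Near u v a → Near v u a
  near-sym (k , k≤ , W) = k , k≤ , reverse-walk W

  near-trans : ∀ {u v w a b} → Near u v a → Near v w b → Near u w (a + b)
  near-trans (k , k≤ , V) (m , m≤ , W) = k + m , +-mono-≤ k≤ m≤ , V ◅◅ W

  climb : ∀ i k x → i + k < ℓ + 2 → Near (node i x) (node (i + k) x) k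
  climb i zero x _ = subst (λ j → Near (node i x) (node j x) 0) (sym (+-identityʳ i)) (near-refl _)
  climb i (suc k) x i+k< rewrite +-suc i k =
    near-trans {a = 1} (near-step (vertical x (≤-trans (s≤s (s≤s (m≤m+n i k))) i+k<))) (climb (suc i) k x i+k<)

  along : ∀ x k → Near (node 0 x) (node 0 (x + k)) k
  along x zero = subst (λ y → Near (node 0 x) (node 0 y) 0) (sym (+-identityʳ x)) (near-refl _)
  along x (suc k) rewrite +-suc x k = near-trans {a = 1} (near-step (ring x)) (along (suc x) k)

  -- One of the two truncated differences vanishes and the other is |x - y|; walks in increasing
  -- direction suffice, since walks can be reversed.
  by-difference : (f : ℕ → HVert ℓ r) (P : ℕ → Set) → (∀ x k → P (x + k) → Near (f x) (f (x + k)) k) →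
    ∀ x y → P x → P y → Near (f x) (f y) ((x ∸ y) + (y ∸ x))
  by-difference f P walk x y px py with ≤-total x y
  ... | inj₁ x≤y = subst₂ (λ y' d → Near (f x) (f y') d) (m+[n∸m]≡n x≤y) (cong (_+ (y ∸ x)) (sym (m≤n⇒m∸n≡0 x≤y)))
    (walk x (y ∸ x) (subst P (sym (m+[n∸m]≡n x≤y)) py))
  ... | inj₂ y≤x = near-sym (subst₂ (λ x' d → Near (f y) (f x') d) (m+[n∸m]≡n y≤x)
    (trans (sym (+-identityʳ _)) (cong ((x ∸ y) +_) (sym (m≤n⇒m∸n≡0 y≤x))))
    (walk y (x ∸ y) (subst P (sym (m+[n∸m]≡n y≤x)) px)))

  place : ℕ → Coord → HVert ℓ r
  place p (i , t , s) = node i (column (t + p , s))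

  -- Windows stay clear of the top ring, because `crossbar` covers rows 0 to ℓ.
  InRow : Coord → Set
  InRow (i , _) = i ≤ ℓ

  below-top : ∀ {i} → i ≤ ℓ → i < ℓ + 2
  below-top i≤ = ≤-trans (s≤s i≤) (≤-trans (n≤1+n _) (≤-reflexive (+-comm 2 ℓ)))

  near-vertical : ∀ {i i'} x → i ≤ ℓ → i' ≤ ℓ → Near (node i x) (node i' x) ((i ∸ i') + (i' ∸ i))
  near-vertical {i} {i'} x i≤ i'≤ = by-difference (λ i → node i x) (_< ℓ + 2) (λ i k → climb i k x) i i' (below-top i≤) (below-top i'≤)

  near-bottom : ∀ {i} x → i ≤ ℓ → Near (node i x) (node 0 x) i
  near-bottom {i} x i≤ = near-sym (climb 0 i x (below-top i≤))

  near-ring : ∀ b c c' → Near (node 0 (b + c)) (node 0 (b + c')) ((c ∸ c') + (c' ∸ c))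
  near-ring b c c' = by-difference (λ c → node 0 (b + c)) (λ _ → ⊤)
    (λ c k _ → subst (λ y → Near (node 0 (b + c)) (node 0 y) k) (+-assoc b c k) (along (b + c) k)) c c' tt tt

  near-side : ∀ {i} n s s' → i ≤ ℓ → Near (node i (column (n , s))) (node i (column (n , s'))) (if s ≡ˢ s' then 0 else 1)
  near-side n false false _ = near-refl _
  near-side n true true _ = near-refl _
  near-side n false true i≤ = near-step (crossbar n i≤)
  near-side n true false i≤ = near-sym (near-step (crossbar n i≤))

  -- `distance` is the length of a particular walk, hence an upper bound: within a ladder along one
  -- side and across a rung, between ladders down to the bottom ring, along it and up again.
  near-window : ∀ p q q' → InRow q → InRow q' → Near (place p q) (place p q') (distance q q')
  near-window p (i , t , s) (i' , t' , s') i≤ i'≤ with t ≡ᵇ t' in eq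
  ... | true rewrite ≡ᵇ⇒≡ t t' (subst T (sym eq) tt) =
    near-trans (near-vertical (column (t' + p , s)) i≤ i'≤) (near-side (t' + p) s s' i'≤)
  ... | false = subst (Near _ _) (shuffle i i' _)
    (near-trans (near-bottom _ i≤) (near-trans
      (subst₂ (λ x x' → Near (node 0 x) (node 0 x') ((c ∸ c') + (c' ∸ c))) (sym (column-+ t p s)) (sym (column-+ t' p s'))
        (near-ring (2 * p) c c'))
      (near-sym (near-bottom _ i'≤))))
    where
    c = column (t , s)
    c' = column (t' , s')
    shuffle : ∀ a b d → a + (d + b) ≡ a + b + d
    shuffle = solve-∀

  distance-refl : ∀ q → distance q q ≡ 0
  distance-refl (i , t , s) with t ≡ᵇ t | ≡⇒≡ᵇ t t refl
  ... | true | _ rewrite n∸n≡0 i = same s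
    where
    same : ∀ s → (if s ≡ˢ s then 0 else 1) ≡ 0
    same false = refl
    same true = refl

  -- A window of at most r ladders does not overlap itself on the ring.
  place-injective : ∀ {w} p q q' → w ≤ r → InRow q → InRow q' → proj₁ (proj₂ q) < w → proj₁ (proj₂ q') < w →
    place p q ≡ place p q' → q ≡ q'
  place-injective p (i , t , s) (i' , t' , s') w≤r i≤ i'≤ t<w t'<w eq =
    cong₂ _,_ (trans (sym (toℕ-row (below-top i≤))) (trans (cong (toℕ ∘ proj₁) eq) (toℕ-row (below-top i'≤))))
      (trans (sym (ladderSide-column (t , s))) (trans (cong ladderSide columns) (ladderSide-column (t' , s'))))
    where
    columns : column (t , s) ≡ column (t' , s')
    columns = %-window-injective {b = 2 * p} (column-bound s (≤-trans t<w w≤r)) (column-bound s' (≤-trans t'<w w≤r))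
      (subst₂ (λ x y → x % (2 * r) ≡ y % (2 * r)) (column-+ t p s) (column-+ t' p s')
        (trans (sym (toℕ-column (column (t + p , s)))) (trans (cong (toℕ ∘ proj₂) eq) (toℕ-column (column (t' + p , s'))))))

  module Coloured {K} (π : HVert ℓ r → ℕ) (packing : IsPackingColouring (H ℓ r) K π) where

    shade : ℕ → Coord → ℕ
    shade p q = π (place p q)

    shade-palette : ∀ p q → shade p q ∈ palette K
    shade-palette p q with π (place p q) | proj₁ packing (place p q)
    ... | suc c | _ , c<K = ∈-map⁺ suc (∈-upTo⁺ c<K)

    module _ (h w p : ℕ) (h≤ℓ : h ≤ suc ℓ) (w≤r : w ≤ r) where
      open Refutation h w

      separated : ∀ q q' → T (inside q) → T (inside q') → shade p q ≡ shade p q' →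
        1 ≤ distance q q' → ¬ distance q q' ≤ shade p q
      separated q@(i , t , s) q'@(i' , t' , s') in₁ in₂ same pos close
        with ∧-elim (i <ᵇ h) in₁ | ∧-elim (i' <ᵇ h) in₂
      ... | i< , t< | i'< , t'< = proj₂ packing (place p q) (place p q') (shade p q) distinct refl (sym same)
          (let (k , k≤ , W) = near-window p q q' i≤ i'≤ in k , ≤-trans k≤ close , W)
        where
        i≤ = ≤-pred (≤-trans (<ᵇ⇒< i h i<) h≤ℓ)
        i'≤ = ≤-pred (≤-trans (<ᵇ⇒< i' h i'<) h≤ℓ)
        distinct : ¬ (place p q ≡ place p q')
        distinct eq with place-injective p q q' w≤r i≤ i'≤ (<ᵇ⇒< t w t<) (<ᵇ⇒< t' w t'<) eq
        ... | refl = <⇒≱ pos (≤-reflexive (distance-refl q))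

      window-refuted : ∀ {tasks} → T (refute tasks []) → ¬ All (λ (q , cs) → shade p q ∈ cs) tasks
      window-refuted ok γ∈ = refute-sound (shade p) separated γ∈ [] ok

    mono-shades : ∀ p qs → All (λ (q , cs) → shade p q ∈ cs) (mono (palette K) qs)
    mono-shades p [] = []
    mono-shades p (q ∷ qs) = shade-palette p q ∷ mono-shades p qs

    module Rim (3≤ℓ : 3 ≤ ℓ) (3≤r : 3 ≤ r) where
      apart : ∀ p q q' → T (Refutation.inside 4 3 q) → T (Refutation.inside 4 3 q') → 1 ≤ distance q q' →
        distance q q' ≤ shade p q → ¬ shade p q ≡ shade p q'
      apart p q q' in₁ in₂ pos close same = separated 4 3 p (s≤s 3≤ℓ) 3≤r q q' in₁ in₂ same pos close

      rim : ℕ → Bool → ℕ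
      rim p s = shade p (0 , 0 , s)

      rim-positive : ∀ p s → 1 ≤ rim p s
      rim-positive p s = proj₁ (proj₁ packing (place p (0 , 0 , s)))

      rim-rung : ∀ p → ¬ rim p false ≡ rim p true
      rim-rung p = apart p (0 , 0 , false) (0 , 0 , true) tt tt ≤-refl (rim-positive p false)

      rim-link : ∀ p → ¬ rim p true ≡ rim (suc p) false
      rim-link p = apart p (0 , 0 , true) (0 , 1 , false) tt tt ≤-refl (rim-positive p true)

      -- The two vertices are two steps apart on the bottom ring, so only colour 1 may repeat.
      rim-next : ∀ p s → 2 ≤ rim p s → ¬ rim p s ≡ rim (suc p) s
      rim-next p false = apart p (0 , 0 , false) (0 , 1 , false) tt tt (s≤s z≤n)
      rim-next p true = apart p (0 , 0 , true) (0 , 1 , true) tt tt (s≤s z≤n)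

      rim-periodic : ∀ p s → rim (p + r) s ≡ rim p s
      rim-periodic p s = cong π (trans (cong (node 0) (trans (column-+ p r s) (+-comm (2 * r) _))) (node-periodic 0 (column (p , s))))

      rim-multiperiodic : ∀ k p s → rim (p + k * r) s ≡ rim p s
      rim-multiperiodic zero p s = cong (λ x → rim x s) (+-identityʳ p)
      rim-multiperiodic (suc k) p s = begin
        rim (p + (r + k * r)) s ≡⟨ cong (λ x → rim x s) (lemma p r (k * r)) ⟩
        rim (p + k * r + r) s   ≡⟨ rim-periodic (p + k * r) s ⟩
        rim (p + k * r) s       ≡⟨ rim-multiperiodic k p s ⟩
        rim p s                 ∎
        where
        open ≡-Reasoning
        lemma : ∀ a b c → a + (b + c) ≡ a + c + b
        lemma = solve-∀

-- Alternating sequences of 2 and 3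

not-first : ∀ {c : ℕ} {x xs} → c ∈ x ∷ xs → ¬ c ≡ x → c ∈ xs
not-first (here c≡x) c≢x = ⊥-elim (c≢x c≡x)
not-first (there c∈) _ = c∈

two-or-three : ∀ {c} → c ∈ palette 5 → ¬ c ≡ 1 → ¬ c ∈ 4 ∷ 5 ∷ [] → c ∈ 2 ∷ 3 ∷ []
two-or-three c∈ c≢1 c∉ with not-first c∈ c≢1
... | here e = here e
... | there (here e) = there (here e)
... | there (there c∈′) = ⊥-elim (c∉ c∈′)

module _ (c : ℕ → ℕ) (c∈ : ∀ p → c p ∈ 2 ∷ 3 ∷ []) (c≢ : ∀ p → ¬ c p ≡ c (suc p)) where
  two-steps : ∀ p → c (suc (suc p)) ≡ c p
  two-steps p with c p | c (suc p) | c (suc (suc p)) | c∈ p | c∈ (suc p) | c∈ (suc (suc p)) | c≢ p | c≢ (suc p)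
  ... | _ | _ | _ | here refl | here refl | _ | ne | _ = ⊥-elim (ne refl)
  ... | _ | _ | _ | there (here refl) | there (here refl) | _ | ne | _ = ⊥-elim (ne refl)
  ... | _ | _ | _ | _ | here refl | here refl | _ | ne = ⊥-elim (ne refl)
  ... | _ | _ | _ | _ | there (here refl) | there (here refl) | _ | ne = ⊥-elim (ne refl)
  ... | _ | _ | _ | here refl | there (here refl) | here refl | _ | _ = refl
  ... | _ | _ | _ | there (here refl) | here refl | there (here refl) | _ | _ = refl

  even-steps : ∀ m → c (2 * m) ≡ c 0
  even-steps zero = refl
  even-steps (suc m) = trans (cong c (*-suc 2 m)) (trans (two-steps (2 * m)) (even-steps m))

  -- The sequence returns to its first value after an even number of steps, so an odd period would
  -- give two equal neighbours.
  no-odd-period : ∀ m → ¬ c (suc (2 * m)) ≡ c 0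
  no-odd-period m eq = c≢ (2 * m) (trans (even-steps m) (sym eq))

≥2 : ∀ {c} → c ∈ 2 ∷ 3 ∷ [] → 2 ≤ c
≥2 (here refl) = ≤-refl
≥2 (there (here refl)) = n≤1+n 2

-- Lower bounds

no-4-colouring : ∀ ℓ r → 3 ≤ ℓ → 2 ≤ r → ¬ HasPackingColouring (H ℓ r) 4
no-4-colouring ℓ r 3≤ℓ 2≤r (π , packing) =
  window-refuted 3 2 0 (≤-trans 3≤ℓ (n≤1+n ℓ)) 2≤r {mono (palette 4) order₄} refutation₄ (mono-shades 0 order₄)
  where
  open Windows ℓ r (≤-trans (s≤s z≤n) 2≤r)
  open Coloured π packing

module _ (ℓ m : ℕ) (3≤ℓ : 3 ≤ ℓ) (3≤r : 3 ≤ suc (2 * m)) (π : HVert ℓ (suc (2 * m)) → ℕ)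
         (packing : IsPackingColouring (H ℓ (suc (2 * m))) 5 π) where
  private r = suc (2 * m)
  open Windows ℓ r (s≤s z≤n)
  open Coloured π packing
  open Rim 3≤ℓ 3≤r

  refuted : ∀ p {tasks} → T (Refutation.refute 4 3 tasks []) → ¬ All (λ (q , cs) → shade p q ∈ cs) tasks
  refuted p {tasks} = window-refuted 4 3 p (s≤s 3≤ℓ) 3≤r {tasks}

  -- The refuted window starts at ladder p, so its middle ladder is p + 1.
  rim-one : ∀ p → ¬ rim (suc p) false ≡ 1 → rim (suc p) true ≡ 1
  rim-one p no-left with rim (suc p) true ≟ 1
  ... | yes right₁ = right₁
  ... | no no-right = ⊥-elim (refuted p {tasksRung} refutationRung
    (not-first (shade-palette p (0 , 1 , false)) no-left ∷
     not-first (shade-palette p (0 , 1 , true)) no-right ∷ mono-shades p orderRung))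

  -- The right ends cannot be 1, being adjacent to a 1, nor 4 or 5 by `refutationLeft`. They would
  -- alternate between 2 and 3 around a ring of r ladders with r odd.
  all-left : (∀ p → rim (suc p) false ≡ 1) → ⊥
  all-left ones = no-odd-period c c∈ (λ p → rim-next (suc p) true (≥2 (c∈ p))) m (rim-periodic 1 true)
    where
    c : ℕ → ℕ
    c p = rim (suc p) true
    c∈ : ∀ p → c p ∈ 2 ∷ 3 ∷ []
    c∈ p = two-or-three (shade-palette (suc p) (0 , 0 , true))
      (λ c≡1 → rim-rung (suc p) (trans (ones p) (sym c≡1)))
      (λ c∈45 → refuted (suc p) {tasksLeft} refutationLeft
        (here (ones p) ∷ here (ones (suc p)) ∷ here (ones (suc (suc p))) ∷ c∈45 ∷ mono-shades (suc p) orderRim))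

  all-right : (∀ p → rim (suc p) true ≡ 1) → ⊥
  all-right ones = no-odd-period c c∈ (λ p → rim-next (3 + p) false (≥2 (c∈ p))) m (rim-periodic 3 false)
    where
    -- In the mirrored window the left end in question belongs to the third ladder; for a window
    -- starting at p + 1 this is ladder p + 3.
    c : ℕ → ℕ
    c p = rim (3 + p) false
    c∈ : ∀ p → c p ∈ 2 ∷ 3 ∷ []
    c∈ p = two-or-three (shade-palette (3 + p) (0 , 0 , false))
      (λ c≡1 → rim-rung (3 + p) (trans c≡1 (sym (ones (2 + p)))))
      (λ c∈45 → refuted (suc p) {tasksRight} refutationRight
        (here (ones (2 + p)) ∷ here (ones (suc p)) ∷ here (ones p) ∷ c∈45 ∷ mono-shades (suc p) (map mirror orderRim)))

  -- The left end of the next rung is adjacent to this 1, so `rim-one` puts the 1 of that rung on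
  -- the right.
  right-next : ∀ p → rim p true ≡ 1 → rim (suc p) true ≡ 1
  right-next p right₁ = rim-one p (λ left₁ → rim-link p (trans right₁ (sym left₁)))

  right-from : ∀ p k → rim p true ≡ 1 → rim (k + p) true ≡ 1
  right-from p zero right₁ = right₁
  right-from p (suc k) right₁ = right-next (k + p) (right-from p k right₁)

  -- A ladder with its 1 on the right passes this on to the next ladder, hence all around the ring.
  right-back : ∀ p → rim (suc p) true ≡ 1 → rim 1 true ≡ 1
  right-back p right₁ = begin
    rim 1 true                       ≡⟨ rim-multiperiodic p 1 true ⟨
    rim (suc (p * r)) true           ≡⟨ cong (λ x → rim x true) around ⟨
    rim (p * r ∸ p + suc p) true     ≡⟨ right-from (suc p) (p * r ∸ p) right₁ ⟩
    1                                ∎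
    where
    open ≡-Reasoning
    around : p * r ∸ p + suc p ≡ suc (p * r)
    around = trans (+-suc _ p) (cong suc (m∸n+n≡m (m≤m*n p r)))

  -- Ladder 1 decides for the whole ring: a 1 on its right spreads to all later ladders, while
  -- otherwise no ladder can have its 1 on the right, as that would spread back to ladder 1.
  odd-contradiction : ⊥
  odd-contradiction with rim 1 true ≟ 1
  ... | yes right₁ = all-right (λ p → subst (λ x → rim x true ≡ 1) (+-comm p 1) (right-from 1 p right₁))
  ... | no no-right = all-left ones
    where
    ones : ∀ p → rim (suc p) false ≡ 1
    ones p with rim (suc p) false ≟ 1
    ... | yes left₁ = left₁
    ... | no no-left = ⊥-elim (no-right (right-back p (rim-one p no-left)))

no-5-colouring : ∀ ℓ m → 3 ≤ ℓ → 3 ≤ suc (2 * m) → ¬ HasPackingColouring (H ℓ (suc (2 * m))) 5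
no-5-colouring ℓ m 3≤ℓ 3≤r (π , packing) = odd-contradiction ℓ m 3≤ℓ 3≤r π packing

-- Both bounds combined

weaken : ∀ {G j k} → j ≤ k → HasPackingColouring G j → HasPackingColouring G k
weaken j≤k (π , range , separated) =
  π , (λ v → proj₁ (range v) , ≤-trans (proj₂ (range v)) j≤k) , separated

theorem17 : (ℓ r : ℕ) → 3 ≤ ℓ → ¬ (ℓ ≡ 5) → 2 ≤ r →
    (Even r → PackingChromaticNumber (H ℓ r) 5) ×
    (Odd r → PackingChromaticNumber (H ℓ r) 6)
theorem17 ℓ r 3≤ℓ ℓ≢5 2≤r = even , odd
  where
  even : Even r → PackingChromaticNumber (H ℓ r) 5
  even (m , refl) = even-colouring ℓ m 3≤ℓ ℓ≢5 ,
    λ k k<5 colouring → no-4-colouring ℓ r 3≤ℓ 2≤r (weaken (≤-pred k<5) colouring)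
  odd : Odd r → PackingChromaticNumber (H ℓ r) 6
  odd (zero , refl) = ⊥-elim (<-irrefl refl 2≤r)
  odd (suc m , refl) =
    subst (λ r → HasPackingColouring (H ℓ r) 6) (cong suc (sym (*-suc 2 m))) (odd-colouring ℓ m 3≤ℓ ℓ≢5) ,
    λ k k<6 colouring → no-5-colouring ℓ (suc m) 3≤ℓ
      (s≤s (≤-trans (m≤m+n 2 (2 * m)) (≤-reflexive (sym (*-suc 2 m))))) (weaken (≤-pred k<6) colouring)
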